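{- It is decidable, given a local rule $f:\mathcal{D}^r_\pi\to\mathcal{G}_\pi$ and a bound $s\in\mathbb{N}$, whether $f$ is bounded-star preserving with bound $s$, i.e. whether the dynamics $F$ induced by $f$ is such that for every graph $G$ that is bounded-star of bound $s$, the graph $F(G)$ is also bounded-star of bound $s$.
   Context: **Graphs.** Let $\pi=\{a,b,c\}$ (the set of ports), identified cyclically with $\mathbb{Z}/3\mathbb{Z}$ so that $p+1$ and $p-1$ make sense for a port $p$. Let $V$ be a fixed uncountable set of possible vertex names. A graph $G$ is given by an at most countable set $V(G)\subseteq V$ of vertices and a set $E(G)$ of pairwise disjoint two-element subsets of $V(G)\times\pi$, called edges. An element $(u,p)$ of $V(G)\times\pi$ is written $u:p$; an edge $\{u:p,v:q\}$ links port $p$ of $u$ to port $q$ of $v$. The set of graphs is denoted $\mathcal{G}_\pi$. (Graphs are unlabelled here.) **Disks.** For a graph $G$, $v\in V(G)$ and an integer $r\ge 0$, $G^r_v$ denotes the disk of radius $r$ of $G$ centred at $v$: the subgraph of $G$ induced by the vertices at graph distance at most $r$ from $v$, together with the distinguished centre $v$. The set of all disks of radius $r$ is $\mathcal{D}^r_\pi$. **Isomorphisms.** A bijection $R:V\to V$ acts on graphs by renaming vertices: $V(R(G))=R(V(G))$ and $\{u:k,v:l\}\in E(G)\Leftrightarrow\{R(u):k,R(v):l\}\in E(R(G))$ (on a disk it also renames the centre). For a bound $b$, $R$ induces $R^*$ on graphs whose vertices are subsets of $V.\{\varepsilon,1,\dots,b\}$ (the set of names $u.i$ with $u\in V$, $i\in\{\varepsilon,1,\dots,b\}$)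 by renaming each vertex according to $R^*(\{u.i,v.j,\dots\})=\{R(u).i,R(v).j,\dots\}$. Such subsets are admitted as vertex names for graphs produced by local rules; graphs with such vertex names are still regarded as elements of $\mathcal{G}_\pi$. **Consistency and union.** Graphs $G,H$ are consistent if for all vertices $u,v,w$ and ports $k,l,p$: $\{u:k,v:l\}\in E(G)$ and $\{u:k,w:p\}\in E(H)$ imply $w=v$ and $l=p$. The union of consistent graphs has as vertex set the union of the vertex sets and as edge set the union of the edge sets. **Local rule.** A function $f:\mathcal{D}^r_\pi\to\mathcal{G}_\pi$ is a local rule (of radius $r$) if there is a bound $b$ such that: (i) for every disk $D$, every $v'\in V(f(D))$ satisfies $v'\subseteq V(D).\{\varepsilon,1,\dots,b\}$; (ii) for every graph $G$ and all disks $D_1,D_2$ of radius $r$ of $G$, $f(D_1)$ and $f(D_2)$ are consistent; (iii) for every disk $D$ and every bijection $R:V\to V$, $f(R(D))=R^*(f(D))$. The dynamics induced by $f$ is $F(G)=\bigcup_{v\in V(G)}f(G^r_v)$ for every graph $G$. By (iii), $f$ is determined by its values on one representative of each of the finitely many isomorphism classes of disks of radius $r$; a local rule is given as input to an algorithm by $r$, $b$ and this finite table. **Paths.** Let $\Pi=\pi^2$. A word $w=w_0\cdots w_{n-1}\in\Pi^*$ with $w_i=q_ip_i$ is a path of length $n$ of $G$ if there exist $v_0,\dots,v_n\in V(G)$ with $\{v_i:q_i,v_{i+1}:p_i\}\in E(G)$ for all $0\le i\le n-1$. The path alternates at $i$ (for $0\le i\le n-3$) if either $p_i=q_{i+1}+1$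 and $p_{i+1}=q_{i+2}-1$, or $p_i=q_{i+1}-1$ and $p_{i+1}=q_{i+2}+1$. A path is monotonous ($0$-alternating) if it does not alternate at any $i$. **Bounded-star.** A graph $G$ is bounded-star of bound $s$ if all its monotonous paths have length less than or equal to $s$. -}

module Defs where

open import Data.Fin.Base using (Fin; toℕ; inject₁) renaming (suc to fsuc)
open import Data.Fin.Patterns using (0F; 1F; 2F)
open import Data.List.Base as List using (List; length; lookup)
open import Data.List.Membership.Propositional using (_∈_)
import Data.List.Relation.Unary.Any as ListAny
open import Data.Maybe.Base as Maybe using (Maybe; just; nothing)
import Data.Maybe.Relation.Unary.Any as MaybeAny
open import Data.Nat.Base using (ℕ; zero; suc; _+_; _≤_)
open import Data.Nat.Properties using (+-identityʳ; +-suc)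
open import Data.Product
  using (Σ-syntax; ∃; ∃₂; ∃!; ∃-syntax; _×_; _,_; proj₁; proj₂; map₁)
open import Data.Product.Relation.Binary.Pointwise.NonDependent using (_×ₛ_)
open import Data.Sum.Base using (_⊎_)
open import Function.Base using (_∘_; id)
open import Function.Bundles using (Func; Inverse; _↔_; _⟨$⟩_)
import Function.Bundles as Fun
open import Function.Definitions using (Injective)
open import Level using (Level; 0ℓ; _⊔_) renaming (suc to lsuc)
open import Relation.Binary.Bundles using (Setoid)
open import Relation.Binary.Core using (Rel; _⇔_)
open import Relation.Binary.Definitions using (Symmetric; _Respects_; _Respects₂_)
open import Relation.Binary.PropositionalEquality as ≡ using (_≡_; refl)
open import Relation.Nullary.Negation.Core using (¬_)
open import Relation.Unary using (Pred; U; _≐_)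
open import Relation.Unary.Relation.Binary.Equality using (≐-setoid)

private
  variable
    c ℓ c′ ℓ′ : Level

------------------------------------------------------------------------
-- Ports

Port : Set
Port = Fin 3

-- p + 1 and p - 1 in ℤ/3ℤ.

_⁺ _⁻ : Port → Port
0F ⁺ = 1F
1F ⁺ = 2F
2F ⁺ = 0F

0F ⁻ = 2F
1F ⁻ = 0F
2F ⁻ = 1F

------------------------------------------------------------------------
-- Countability

-- A surjection from ℕ onto the subset P with one extra point adjoined, so
-- that finite and empty subsets are countable.

Countable : (N : Setoid c ℓ) → Pred (Setoid.Carrier N) 0ℓ → Set (c ⊔ ℓ)
Countable N P =
  Σ[ e ∈ (ℕ → Maybe (∃ P)) ]
    (∀ {v} → P v → ∃[ n ] MaybeAny.Any (λ u → proj₁ u ≈ v) (e n))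
  where open Setoid N

Uncountable : Set → Set
Uncountable V = ¬ Countable (≡.setoid V) U

unpair : ℕ → ℕ × ℕ
unpair zero    = 0 , 0
unpair (suc n) with unpair n
... | i , zero  = 0 , suc i
... | i , suc j = suc i , j

unpair-surjective : ∀ i j → ∃[ n ] unpair n ≡ (i , j)
unpair-surjective i j = onDiagonal (i + j) i j refl
  where
  onDiagonal : ∀ d i j → i + j ≡ d → ∃[ n ] unpair n ≡ (i , j)
  onDiagonal zero zero zero refl = 0 , refl
  onDiagonal (suc d) zero (suc .d) refl
    with onDiagonal d d zero (+-identityʳ d)
  ... | n , eq = suc n , next eq
    where
    next : unpair n ≡ (d , zero) → unpair (suc n) ≡ (zero , suc d)
    next eq rewrite eq = refl
  onDiagonal d (suc i) j eq
    with onDiagonal d i (suc j) (≡.trans (+-suc i j) eq)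
  ... | n , eq′ = suc n , next eq′
    where
    next : unpair n ≡ (i , suc j) → unpair (suc n) ≡ (suc i , j)
    next eq rewrite eq = refl

------------------------------------------------------------------------
-- Graphs

-- Vertex names form a setoid because names that are sets of names are
-- compared extensionally.

HalfEdges : Setoid c ℓ → Setoid c ℓ
HalfEdges N = N ×ₛ ≡.setoid Port

-- The set of edges is the set of all {x , y} with edge x y.

record PortGraph (N : Setoid c ℓ) : Set (c ⊔ ℓ ⊔ lsuc 0ℓ) where
  open Setoid N using (Carrier) renaming (_≈_ to _≈ᵛ_)
  open Setoid (HalfEdges N) using () renaming (Carrier to Half; _≈_ to _≈ʰ_)
  field
    vertex          : Pred Carrier 0ℓ
    edge            : Rel Half 0ℓ
    vertex-resp     : vertex Respects _≈ᵛ_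
    edge-resp       : edge Respects₂ _≈ʰ_
    edge-sym        : Symmetric edge
    edge-twoElement : ∀ {x y} → edge x y → ¬ (x ≈ʰ y)
    edge-disjoint   : ∀ {x y z} → edge x y → edge x z → y ≈ʰ z
    edge-vertex     : ∀ {x y} → edge x y → vertex (proj₁ x)

open PortGraph public

record Graph (N : Setoid c ℓ) : Set (c ⊔ ℓ ⊔ lsuc 0ℓ) where
  field
    portGraph : PortGraph N
    countable : Countable N (vertex portGraph)

open Graph public

infix 4 _≈ᴳ_

_≈ᴳ_ : {N : Setoid c ℓ} → Rel (PortGraph N) c
G ≈ᴳ H = (vertex G ≐ vertex H) × (edge G ⇔ edge H)

graphSetoid : Setoid c ℓ → Setoid (c ⊔ ℓ ⊔ lsuc 0ℓ) c
graphSetoid N = record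
  { Carrier       = Graph N
  ; _≈_           = λ G H → portGraph G ≈ᴳ portGraph H
  ; isEquivalence = record
    { refl  = (id , id) , (id , id)
    ; sym   = λ { ((a , b) , (c , d)) → (b , a) , (d , c) }
    ; trans = λ { ((a , b) , (c , d)) ((a′ , b′) , (c′ , d′)) →
                  (a′ ∘ a , b ∘ b′) , (c′ ∘ c , d ∘ d′) }
    }
  }

Consistent : {N : Setoid c ℓ} → PortGraph N → PortGraph N → Set (c ⊔ ℓ)
Consistent {N = N} G H =
  ∀ {u v w k l p} → edge G (u , k) (v , l) → edge H (u , k) (w , p) →
  w ≈ v × l ≡ p
  where open Setoid N

------------------------------------------------------------------------
-- Renaming

module _ {N : Setoid c ℓ} {M : Setoid c′ ℓ′} (R : Inverse N M) where
  private
    module N = Setoid N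
    module M = Setoid M
  open Inverse R

  private
    from-injective : ∀ {x y} → from x N.≈ from y → x M.≈ y
    from-injective {x} {y} eq =
      M.trans (M.sym (strictlyInverseˡ x))
              (M.trans (to-cong eq) (strictlyInverseˡ y))

  -- The image of a set under R is its preimage under R⁻¹.

  renamePortGraph : PortGraph N → PortGraph M
  renamePortGraph G = record
    { vertex          = vertex G ∘ from
    ; edge            = λ x y → edge G (map₁ from x) (map₁ from y)
    ; vertex-resp     = λ eq → vertex-resp G (from-cong eq)
    ; edge-resp       =
        (λ { (eq , p) → proj₁ (edge-resp G) (from-cong eq , p) }) ,
        (λ { (eq , p) → proj₂ (edge-resp G) (from-cong eq , p) })
    ; edge-sym        = edge-sym G
    ; edge-twoElement = λ { e (eq , p) →
        edge-twoElement G e (from-cong eq , p) }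
    ; edge-disjoint   = λ e e′ →
        let eq , p = edge-disjoint G e e′ in from-injective eq , p
    ; edge-vertex     = edge-vertex G
    }

  renameGraph : Graph N → Graph M
  renameGraph G = record
    { portGraph = renamePortGraph (portGraph G)
    ; countable = Maybe.map push ∘ proj₁ (countable G) , λ v∈G →
        let n , hit = proj₂ (countable G) v∈G in n , pushHit hit
    }
    where
    push : ∃ (vertex (portGraph G)) → ∃ (vertex (portGraph G) ∘ from)
    push (u , u∈G) =
      to u , vertex-resp (portGraph G) (N.sym (strictlyInverseʳ u)) u∈G

    pushHit : ∀ {v m} → MaybeAny.Any (λ u → proj₁ u N.≈ from v) m →
              MaybeAny.Any (λ u → proj₁ u M.≈ v) (Maybe.map push m)
    pushHit (MaybeAny.just eq) =
      MaybeAny.just (M.trans (to-cong eq) (strictlyInverseˡ _))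

------------------------------------------------------------------------
-- Paths

Word : ℕ → Set
Word n = Fin n → Port × Port

module _ {n} (w : Word n) where

  -- The i-th letter of w is q i p i.

  q p : Fin n → Port
  q = proj₁ ∘ w
  p = proj₂ ∘ w

  AlternatesAt : Fin n → Set
  AlternatesAt i =
    ∃₂ λ j k → toℕ j ≡ 1 + toℕ i × toℕ k ≡ 2 + toℕ i ×
      ((p i ≡ q j ⁺ × p j ≡ q k ⁻) ⊎ (p i ≡ q j ⁻ × p j ≡ q k ⁺))

  Monotonous : Set
  Monotonous = ∀ i → ¬ AlternatesAt i

  IsPath : {N : Setoid c ℓ} → PortGraph N → Set c
  IsPath {N = N} G =
    Σ[ v ∈ (Fin (suc n) → Setoid.Carrier N) ]
      (∀ i → vertex G (v i)) ×
      (∀ i → edge G (v (inject₁ i) , q i) (v (fsuc i) , p i))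

BoundedStar : {N : Setoid c ℓ} → Graph N → ℕ → Set c
BoundedStar G s =
  ∀ {n} (w : Word n) → IsPath w (portGraph G) → Monotonous w → n ≤ s

------------------------------------------------------------------------
-- Finite encodings

-- A finite graph whose vertices are named by codes of type A: the list of
-- its vertices and the list of its edges.

record GraphCode (A : Set) : Set where
  field
    vertices : List A
    edges    : List ((A × Port) × (A × Port))

-- The codes, read through ι, describe exactly G.

record Encodes {N : Setoid c ℓ} {A : Set} (ι : A → Setoid.Carrier N)
               (γ : GraphCode A) (G : PortGraph N) : Set (c ⊔ ℓ) where
  open GraphCode γ
  open Setoid N using () renaming (_≈_ to _≈ᵛ_)
  open Setoid (HalfEdges N) using () renaming (_≈_ to _≈ʰ_)
  field
    encodes-vertex : ∀ v →
      vertex G v Fun.⇔ ListAny.Any (λ a → ι a ≈ᵛ v) vertices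
    encodes-edge : ∀ x y →
      edge G x y Fun.⇔
      ListAny.Any (λ { (a , b) → (map₁ ι a ≈ʰ x × map₁ ι b ≈ʰ y) ⊎
                                 (map₁ ι a ≈ʰ y × map₁ ι b ≈ʰ x) }) edges

-- One row of the table of a local rule with bound b: a disk with n vertices
-- and its image.  The code of a vertex name of the image, a subset of
-- V.{ε,1,…,b}, is the list of its elements; in Fin (suc b), zero stands for
-- ε and i > 0 for itself.

record Entry (b : ℕ) : Set where
  field
    size   : ℕ
    centre : Fin size
    disk   : GraphCode (Fin size)
    image  : GraphCode (List (Fin size × Fin (suc b)))

Table : ℕ → Set
Table b = List (Entry b)

------------------------------------------------------------------------
-- Local rules over a set V of vertex names

module _ (V : Set) where

  Vₛ : Setoid 0ℓ 0ℓ
  Vₛ = ≡.setoid V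

  -- Subsets of V.{ε,1,…,b}.

  Names : ℕ → Setoid (lsuc 0ℓ) 0ℓ
  Names b = ≐-setoid (V × Fin (suc b)) 0ℓ

module _ {V : Set} where

  ----------------------------------------------------------------------
  -- Disks

  -- Distance from u to v at most n.

  data Within (G : PortGraph (Vₛ V)) : ℕ → V → V → Set where
    here : ∀ {n v} → Within G n v v
    step : ∀ {n u v w k l} → edge G (u , k) (w , l) →
           Within G n w v → Within G (suc n) u v

  induced : PortGraph (Vₛ V) → Pred V 0ℓ → PortGraph (Vₛ V)
  induced G P = record
    { vertex          = λ v → vertex G v × P v
    ; edge            = λ x y → edge G x y × P (proj₁ x) × P (proj₁ y)
    ; vertex-resp     = λ { refl → id }
    ; edge-resp       = (λ { (refl , refl) → id }) , (λ { (refl , refl) → id })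
    ; edge-sym        = λ { (e , x∈P , y∈P) → edge-sym G e , y∈P , x∈P }
    ; edge-twoElement = edge-twoElement G ∘ proj₁
    ; edge-disjoint   = λ { (e , _) (e′ , _) → edge-disjoint G e e′ }
    ; edge-vertex     = λ { (e , x∈P , _) → edge-vertex G e , x∈P }
    }

  Pointed : Set₁
  Pointed = PortGraph (Vₛ V) × V

  infix 4 _≈ᴾ_

  _≈ᴾ_ : Rel Pointed 0ℓ
  (G , u) ≈ᴾ (H , v) = G ≈ᴳ H × u ≡ v

  ball : ℕ → PortGraph (Vₛ V) → V → Pointed
  ball r G v = induced G (Within G r v) , v

  record Disk (r : ℕ) : Set₁ where
    field
      pointed : Pointed
      isDisk  : Σ[ G ∈ Graph (Vₛ V) ] Σ[ v ∈ V ]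
                  vertex (portGraph G) v × pointed ≈ᴾ ball r (portGraph G) v

  open Disk public

  diskSetoid : ℕ → Setoid (lsuc 0ℓ) 0ℓ
  diskSetoid r = record
    { Carrier       = Disk r
    ; _≈_           = λ D D′ → pointed D ≈ᴾ pointed D′
    ; isEquivalence = record
      { refl  = ((id , id) , (id , id)) , refl
      ; sym   = λ { (((a , b) , (c , d)) , eq) →
                    ((b , a) , (d , c)) , ≡.sym eq }
      ; trans = λ { (((a , b) , (c , d)) , eq) (((a′ , b′) , (c′ , d′)) , eq′) →
                    ((a′ ∘ a , b ∘ b′) , (c′ ∘ c , d ∘ d′)) , ≡.trans eq eq′ }
      }
    }

  diskAt : ∀ r (G : Graph (Vₛ V)) v → vertex (portGraph G) v → Disk r
  diskAt r G v v∈G = record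
    { pointed = ball r (portGraph G) v
    ; isDisk  = G , v , v∈G , ((id , id) , (id , id)) , refl
    }

  module _ (R : V ↔ V) where
    open Inverse R

    private
      module _ (G : PortGraph (Vₛ V)) where

        within-from : ∀ {n u v} → Within (renamePortGraph R G) n u v →
                      Within G n (from u) (from v)
        within-from here       = here
        within-from (step e w) = step e (within-from w)

        within-to : ∀ {n u v} → Within G n u v →
                    Within (renamePortGraph R G) n (to u) (to v)
        within-to here = here
        within-to (step {u = u} {w = w} e rest) =
          step (≡.subst₂ (λ a b → edge G (a , _) (b , _))
                 (≡.sym (strictlyInverseʳ u)) (≡.sym (strictlyInverseʳ w)) e)
               (within-to rest)

        fwd : ∀ {n v x} → Within G n v (from x) →
              Within (renamePortGraph R G) n (to v) x
        fwd {x = x} w = ≡.subst (Within _ _ _) (strictlyInverseˡ x) (within-to w)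

        bwd : ∀ {n v x} → Within (renamePortGraph R G) n (to v) x →
              Within G n v (from x)
        bwd {v = v} w =
          ≡.subst (λ u → Within G _ u _) (strictlyInverseʳ v) (within-from w)

    renameDisk : ∀ {r} → Disk r → Disk r
    renameDisk record
      { pointed = D , c
      ; isDisk  = G , v , v∈G , ((V⊆ , V⊇) , (E⊆ , E⊇)) , c≡v
      } = record
      { pointed = renamePortGraph R D , to c
      ; isDisk  =
          renameGraph R G , to v ,
          vertex-resp H (≡.sym (strictlyInverseʳ v)) v∈G ,
          ( ( (λ x → let x∈ , w = V⊆ x in x∈ , fwd H w)
            , (λ { (x∈ , w) → V⊇ (x∈ , bwd H w) }) )
          , ( (λ e → let e′ , w , w′ = E⊆ e in e′ , fwd H w , fwd H w′)
            , (λ { (e , w , w′) → E⊇ (e , bwd H w , bwd H w′) }) ) ) ,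
          ≡.cong to c≡v
      }
      where H = portGraph G

    -- R* : v.i belongs to R* m if and only if R⁻¹(v).i belongs to m.

    renameNames : ∀ b → Inverse (Names V b) (Names V b)
    renameNames b = record
      { to        = λ m → m ∘ map₁ from
      ; from      = λ m → m ∘ map₁ to
      ; to-cong   = λ { (a , b) → a , b }
      ; from-cong = λ { (a , b) → a , b }
      ; inverse   =
          (λ { {m} (a , b) →
            (λ {x} → ≡.subst m (≡.cong (_, _) (strictlyInverseˡ _)) ∘ a) ,
            (λ {x} → b ∘ ≡.subst m (≡.cong (_, _) (≡.sym (strictlyInverseˡ _)))) })
        , (λ { {m} (a , b) →
            (λ {x} → ≡.subst m (≡.cong (_, _) (strictlyInverseʳ _)) ∘ a) ,
            (λ {x} → b ∘ ≡.subst m (≡.cong (_, _) (≡.sym (strictlyInverseʳ _)))) })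
      }

  infix 4 _≅_

  _≅_ : ∀ {r} → Rel (Disk r) 0ℓ
  D ≅ D′ = Σ[ R ∈ V ↔ V ] pointed (renameDisk R D) ≈ᴾ pointed D′

------------------------------------------------------------------------
-- Local rules

record LocalRule (V : Set) (r b : ℕ) : Set₁ where
  field
    rule : Func (diskSetoid {V} r) (graphSetoid (Names V b))

  apply : Disk {V} r → Graph (Names V b)
  apply D = rule ⟨$⟩ D

  field
    support     : ∀ D {m} → vertex (portGraph (apply D)) m →
                  ∀ {u i} → m (u , i) → vertex (proj₁ (pointed D)) u
    consistent  : ∀ G u v (u∈G : vertex (portGraph G) u)
                          (v∈G : vertex (portGraph G) v) →
                  Consistent (portGraph (apply (diskAt r G u u∈G)))
                             (portGraph (apply (diskAt r G v v∈G)))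
    equivariant : ∀ (R : V ↔ V) D →
                  portGraph (apply (renameDisk R D)) ≈ᴳ
                  portGraph (renameGraph (renameNames R b) (apply D))

module _ {V : Set} {r b : ℕ} (f : LocalRule V r b) where
  open LocalRule f

  -- The union, over the vertices v of G, of the images of the disks of G.

  dynamics : Graph (Vₛ V) → Graph (Names V b)
  dynamics G = record
    { portGraph = record
      { vertex          = λ m → Σ[ v ∈ V ] Σ[ v∈G ∈ vertex H v ]
                                  vertex (at v v∈G) m
      ; edge            = λ x y → Σ[ v ∈ V ] Σ[ v∈G ∈ vertex H v ]
                                    edge (at v v∈G) x y
      ; vertex-resp     = λ { eq (v , v∈G , m) →
          v , v∈G , vertex-resp (at v v∈G) eq m }
      ; edge-resp       =
          (λ { eq (v , v∈G , e) →
            v , v∈G , proj₁ (edge-resp (at v v∈G)) eq e }) ,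
          (λ { eq (v , v∈G , e) →
            v , v∈G , proj₂ (edge-resp (at v v∈G)) eq e })
      ; edge-sym        = λ { (v , v∈G , e) → v , v∈G , edge-sym (at v v∈G) e }
      ; edge-twoElement = λ { (v , v∈G , e) → edge-twoElement (at v v∈G) e }
      ; edge-disjoint   = λ { (u , u∈G , e) (v , v∈G , e′) →
          let w≈v , l≡p = consistent G u v u∈G v∈G e e′
          in Setoid.sym (Names V b) w≈v , l≡p }
      ; edge-vertex     = λ { (v , v∈G , e) →
          v , v∈G , edge-vertex (at v v∈G) e }
      }
    ; countable = (λ n → let i , j = unpair n in inner (eG i) j) , covers
    }
    where
    H = portGraph G

    at : ∀ v → vertex H v → PortGraph (Names V b)
    at v v∈G = portGraph (apply (diskAt r G v v∈G))

    V′ : Pred (Setoid.Carrier (Names V b)) 0ℓ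
    V′ m = Σ[ v ∈ V ] Σ[ v∈G ∈ vertex H v ] vertex (at v v∈G) m

    eG = proj₁ (countable G)

    inner : Maybe (∃ (vertex H)) → ℕ → Maybe (∃ V′)
    inner nothing          j = nothing
    inner (just (v , v∈G)) j =
      Maybe.map (λ { (m , m∈) → m , v , v∈G , m∈ })
        (proj₁ (countable (apply (diskAt r G v v∈G))) j)

    at-irrelevant : ∀ {v} (a a′ : vertex H v) → at v a ≈ᴳ at v a′
    at-irrelevant a a′ = Func.cong rule (((id , id) , (id , id)) , refl)

    innerHit : ∀ {v m k} → (∃[ v∈G ] vertex (at v v∈G) m) →
               MaybeAny.Any (λ u → proj₁ u ≡ v) k →
               ∃[ j ] MaybeAny.Any (λ u → proj₁ u ≐ m) (inner k j)
    innerHit (a , m∈) (MaybeAny.just {x = v , a′} refl)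
      with proj₂ (countable (apply (diskAt r G v a′)))
                 (proj₁ (proj₁ (at-irrelevant a a′)) m∈)
    ... | j , hit = j , lift hit
      where
      lift : ∀ {m k} → MaybeAny.Any (λ u → proj₁ u ≐ m) k →
             MaybeAny.Any (λ u → proj₁ u ≐ m)
               (Maybe.map (λ { (m , m∈) → m , v , a′ , m∈ }) k)
      lift (MaybeAny.just eq) = MaybeAny.just eq

    covers : ∀ {m} → V′ m →
             ∃[ n ] MaybeAny.Any (λ u → proj₁ u ≐ m)
                      (let i , j = unpair n in inner (eG i) j)
    covers {m} (v , v∈G , m∈) with proj₂ (countable G) v∈G
    ... | i , hitG with innerHit (v∈G , m∈) hitG
    ...   | j , hit with unpair-surjective i j
    ...     | n , eq = n ,
      ≡.subst (λ z → MaybeAny.Any (λ u → proj₁ u ≐ m)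
                       (inner (eG (proj₁ z)) (proj₂ z)))
              (≡.sym eq) hit

  BoundedStarPreserving : ℕ → Set₁
  BoundedStarPreserving s = ∀ G → BoundedStar G s → BoundedStar (dynamics G) s

  -- The row e gives the value of f at some disk.

  record EntryOf (e : Entry b) : Set₁ where
    open Entry e
    field
      representative : Disk {V} r
      naming         : Fin size → V
      injective      : Injective _≡_ _≡_ naming
      centre-named   : proj₂ (pointed representative) ≡ naming centre
      encodes-disk   : Encodes naming disk (proj₁ (pointed representative))
      encodes-image  :
        Encodes {N = Names V b} (λ l x → x ∈ List.map (map₁ naming) l)
                image (portGraph (apply representative))

  open EntryOf public

  -- The rows of t give the values of f at one representative of each
  -- isomorphism class of disks.

  Tabulates : Table b → Set₁
  Tabulates t =
    Σ[ row ∈ (∀ i → EntryOf (lookup t i)) ]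
      ∀ D → ∃! _≡_ (λ i → D ≅ representative (row i))

module Submission where

-- A monotonous path of length s + 1 in F(G) has s + 1 edges, each of them
-- contributed by the image of one disk of G.  The subgraph of G induced by the
-- vertices of these disks has the same disks at their centres, so the path
-- survives in its image; as a subgraph of G it is still bounded-star of bound s,
-- and its size is bounded in terms of s and the table.  Hence it suffices to
-- search the graphs on Fin k, for bounded k, in which rows of the table can be
-- placed so that chosen edges of their images form such a path.  Conversely, a
-- graph found on Fin k is carried into V by an injection, and there equivariance
-- gives the values of f on its disks, because finite injections into V extend to
-- bijections of V.

open import Defs
open import Axiom.ExcludedMiddle using (ExcludedMiddle)
open import Data.Bool.Base using (Bool; true; false; T)
open import Data.Bool.Properties using (T?)
open import Data.Fin.Base using (Fin; zero; toℕ; fromℕ<; inject₁; inject≤) renaming (suc to fsuc)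
import Data.Fin.Properties as Fin
open import Data.List.Base as List using (List; []; _∷_; length; _++_; deduplicate)
open import Data.List.Membership.Propositional using (_∈_; lose)
open import Data.List.Membership.Propositional.Properties
  using (∈-map⁺; ∈-map⁻; ∈-lookup; ∈-deduplicate⁺; ∈-++⁺ˡ; ∈-++⁺ʳ)
import Data.List.Properties as List
import Data.List.Relation.Unary.All as ListAll
open import Data.List.Relation.Unary.AllPairs using (_∷_)
open import Data.List.Relation.Unary.Any as ListAny using (Any)
import Data.List.Relation.Unary.Any.Properties as ListAny
open import Data.List.Relation.Unary.Unique.Propositional using (Unique)
import Data.List.Relation.Unary.Unique.DecPropositional.Properties as Unique
open import Data.Maybe.Base using (Maybe; just; nothing)
import Data.Maybe.Relation.Unary.Any as MaybeAny
open import Data.Nat.Base using (ℕ; zero; suc; _+_; _*_; _≤_; z≤n; s≤s)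
open import Data.Nat.ListAction using (sum)
import Data.Nat.Properties as ℕ
open import Data.Product using (Σ; Σ-syntax; ∃; ∃-syntax; _×_; _,_; proj₁; proj₂; map₁; swap)
import Data.Product.Properties as Product
open import Data.Sum.Base as Sum using (_⊎_; inj₁; inj₂)
open import Data.Vec.Base as Vec using (Vec; []; _∷_; lookup; tabulate)
import Data.Vec.Membership.Propositional.Properties as Vec∈
import Data.Vec.Properties as Vec
open import Function.Base using (_∘_; id)
open import Function.Bundles using (Func; Inverse; Injection; _↔_; mk↔ₛ′; mk⇔; module Equivalence)
import Function.Bundles as Fun
open import Function.Definitions using (Injective)
open import Function.Properties.Inverse using (↔-refl; ↔-sym; ↔-trans; ↔⇒↣)
open import Level using (Level; 0ℓ; Lift; lift; lower) renaming (suc to lsuc)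
open import Relation.Binary.Bundles using (Setoid)
open import Relation.Binary.Definitions using (DecidableEquality)
open import Relation.Binary.PropositionalEquality as ≡
  using (_≡_; _≢_; _≗_; refl; sym; trans; cong; cong₂; subst; subst₂)
open import Relation.Nullary using (¬_; Dec; yes; no; contradiction)
open import Relation.Nullary.Decidable
  using (map′; _×-dec_; _→-dec_; _⊎-dec_; ¬?; decidable-stable; does; proof)
open import Relation.Nullary.Reflects using (Reflects)
open import Relation.Unary using (Pred; _≐_; _⊆_)
open import Relation.Unary.Properties using (≐-refl; ≐-sym; ≐-trans)

open Encodes
open Entry
open Equivalence using (to; from)
open GraphCode

private
  variable
    c ℓ c′ ℓ′ : Level
    A B C V : Set
    b k n r s : ℕ

-- Exhaustive search

-- Exhaustive search is taken as a closure property of decidability, so that it composes along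
-- dependent pairs and vectors without listing any elements.
Searchable : Set → Set₁
Searchable A = {P : A → Set} → (∀ a → Dec (P a)) → Dec (∃ P)

search-Bool : Searchable Bool
search-Bool P? = map′
  (λ { (inj₁ p) → true , p ; (inj₂ p) → false , p })
  (λ { (true , p) → inj₁ p ; (false , p) → inj₂ p })
  (P? true ⊎-dec P? false)

search-Σ : {B : A → Set} → Searchable A → (∀ a → Searchable (B a)) →
           Searchable (Σ A B)
search-Σ sA sB P? = map′
  (λ { (a , b , p) → (a , b) , p }) (λ { ((a , b) , p) → a , b , p })
  (sA λ a → sB a λ b → P? (a , b))

search-× : Searchable A → Searchable B → Searchable (A × B)
search-× sA sB = search-Σ sA (λ _ → sB)

search-Vec : Searchable A → ∀ n → Searchable (Vec A n)
search-Vec sA zero    P? = map′ (λ p → [] , p) (λ { ([] , p) → p }) (P? [])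
search-Vec sA (suc n) P? = map′
  (λ { ((a , as) , p) → a ∷ as , p }) (λ { (a ∷ as , p) → (a , as) , p })
  (search-× sA (search-Vec sA n) λ { (a , as) → P? (a ∷ as) })

forall? : {P : A → Set} → Searchable A → (∀ a → Dec (P a)) → Dec (∀ a → P a)
forall? sA P? = map′
  (λ ¬∃¬ a → decidable-stable (P? a) (λ ¬p → ¬∃¬ (a , ¬p)))
  (λ { p (a , ¬p) → ¬p (p a) })
  (¬? (sA (¬? ∘ P?)))

infix 3 _⇔-dec_

_⇔-dec_ : {P Q : Set} → Dec P → Dec Q → Dec (P Fun.⇔ Q)
P? ⇔-dec Q? = map′ (λ { (f , g) → mk⇔ f g })
  (λ e → to e , from e)
  ((P? →-dec Q?) ×-dec (Q? →-dec P?))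

-- Chosen witnesses are kept in a vector: unlike functions, vectors can be searched, and by
-- `lookup-ext` they are equal as soon as their entries are.
vec-choice : {P : Fin n → A → Set} → (∀ i → ∃ (P i)) →
             ∃[ as ] (∀ i → P i (lookup {n = n} as i))
vec-choice {P = P} h = tabulate (proj₁ ∘ h) , λ i →
  subst (P i) (sym (Vec.lookup∘tabulate (proj₁ ∘ h) i)) (proj₂ (h i))

lookup-ext : {as bs : Vec A n} → lookup as ≗ lookup bs → as ≡ bs
lookup-ext {as = as} {bs} eq = trans (sym (Vec.tabulate∘lookup as))
  (trans (Vec.tabulate-cong eq) (Vec.tabulate∘lookup bs))

-- Finite injections

unique-lookup-injective : {xs : List A} → Unique xs → Injective _≡_ _≡_ (List.lookup xs)
unique-lookup-injective (_ ∷ _) {zero}   {zero}   _  = refl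
unique-lookup-injective (x∉ ∷ _) {zero}  {fsuc j} eq =
  contradiction eq (ListAll.lookup x∉ (∈-lookup j))
unique-lookup-injective (x∉ ∷ _) {fsuc i} {zero}  eq =
  contradiction (sym eq) (ListAll.lookup x∉ (∈-lookup i))
unique-lookup-injective (_ ∷ u) {fsuc i} {fsuc j} eq =
  cong fsuc (unique-lookup-injective u eq)

module _ (_≟_ : DecidableEquality A) where

  enumerate : (xs : List A) →
    Σ[ k ∈ ℕ ] k ≤ length xs × Σ[ ι ∈ (Fin k → A) ]
      Injective _≡_ _≡_ ι × (∀ {x} → x ∈ xs → ∃[ a ] ι a ≡ x)
  enumerate xs =
    length ys , List.length-deduplicate _≟_ xs , List.lookup ys ,
    unique-lookup-injective (Unique.deduplicate-! _≟_ xs) ,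
    λ x∈ → let x∈′ = ∈-deduplicate⁺ _≟_ x∈ in
           ListAny.index x∈′ , sym (ListAny.lookup-index x∈′)
    where ys = deduplicate _≟_ xs

  transpose : A → A → A → A
  transpose x y z with z ≟ x | z ≟ y
  ... | yes _ | _     = y
  ... | no _  | yes _ = x
  ... | no _  | no _  = z

  transpose-first : ∀ x y → transpose x y x ≡ y
  transpose-first x y with x ≟ x | x ≟ y
  ... | yes _ | _ = refl
  ... | no x≢x | _ = contradiction refl x≢x

  transpose-other : ∀ {x y z} → z ≢ x → z ≢ y → transpose x y z ≡ z
  transpose-other {x} {y} {z} z≢x z≢y with z ≟ x | z ≟ y
  ... | yes e | _     = contradiction e z≢x
  ... | no _  | yes e = contradiction e z≢y
  ... | no _  | no _  = refl

  transpose-involutive : ∀ x y z → transpose x y (transpose x y z) ≡ z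
  transpose-involutive x y z with z ≟ x | z ≟ y
  transpose-involutive x y z | yes refl | _ with y ≟ z | y ≟ y
  ... | yes e | _ = e
  ... | no _ | yes _ = refl
  ... | no _ | no y≢y = contradiction refl y≢y
  transpose-involutive x y z | no _ | yes refl = transpose-first x z
  transpose-involutive x y z | no z≢x | no z≢y = transpose-other z≢x z≢y

  transposition : A → A → A ↔ A
  transposition x y = mk↔ₛ′ (transpose x y) (transpose x y)
    (transpose-involutive x y) (transpose-involutive x y)

  -- Induction on `n`: a bijection `R` that is right on the tail is followed by the transposition of
  -- `R (α 0)` and `β 0`. The other values `β i` stay fixed: they differ from `R (α 0)` because `R`
  -- and `α` are injective, and from `β 0` because `β` is.
  extendInjection : (α β : Fin n → A) → Injective _≡_ _≡_ α → Injective _≡_ _≡_ β →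
    Σ[ R ∈ A ↔ A ] (∀ i → Inverse.to R (α i) ≡ β i)
  extendInjection {n = zero}  α β α-inj β-inj = ↔-refl , λ ()
  extendInjection {n = suc n} α β α-inj β-inj
    with extendInjection (α ∘ fsuc) (β ∘ fsuc)
           (Fin.suc-injective ∘ α-inj) (Fin.suc-injective ∘ β-inj)
  ... | R , R-spec =
    ↔-trans R (transposition x (β zero)) , λ where
      zero     → transpose-first x (β zero)
      (fsuc i) → trans (cong (transpose x (β zero)) (R-spec i))
        (transpose-other
          (λ e → contradiction (α-inj (Injection.injective (↔⇒↣ R) (trans (R-spec i) e))) λ ())
          (λ e → contradiction (β-inj e) λ ()))
    where x = Inverse.to R (α zero)

lower-em : ExcludedMiddle (lsuc 0ℓ) → ExcludedMiddle 0ℓ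
lower-em em {P} = map′ lower lift (em {Lift (lsuc 0ℓ) P})

finite-countable : {P : Pred A 0ℓ} (e : Fin n → Maybe (∃ P)) →
                   (∀ {x} → P x → ∃[ i ] MaybeAny.Any (λ u → proj₁ u ≡ x) (e i)) →
                   Countable (≡.setoid A) P
finite-countable {n = n} {P = P} e hits = enum , λ {x} x∈P →
  let i , hit = hits x∈P in
  toℕ i , subst (MaybeAny.Any (λ u → proj₁ u ≡ x)) (sym (enum-toℕ i)) hit
  where
  enum : ℕ → Maybe (∃ P)
  enum m with m ℕ.<? n
  ... | yes m<n = e (fromℕ< m<n)
  ... | no _    = nothing

  enum-toℕ : ∀ i → enum (toℕ i) ≡ e i
  enum-toℕ i with toℕ i ℕ.<? n
  ... | yes lt = cong e (Fin.fromℕ<-toℕ i lt)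
  ... | no ≮   = contradiction (Fin.toℕ<n i) ≮

-- Fresh elements are adjoined one at a time. If none lay outside the range of `ι`, then `ι` would
-- enumerate `A`, against uncountability.
finiteInjection : ExcludedMiddle 0ℓ → Uncountable A → ∀ n →
                  Σ[ ι ∈ (Fin n → A) ] Injective _≡_ _≡_ ι
finiteInjection em unc zero = (λ ()) , λ { {()} }
finiteInjection {A = A} em unc (suc n)
  with finiteInjection em unc n
... | ι , ι-inj with em {Σ[ x ∈ A ] (∀ a → ι a ≢ x)}
...   | yes (x , x∉) = ι′ , ι′-inj
  where
  ι′ : Fin (suc n) → A
  ι′ zero     = x
  ι′ (fsuc a) = ι a

  ι′-inj : Injective _≡_ _≡_ ι′
  ι′-inj {zero}   {zero}   _  = refl
  ι′-inj {zero}   {fsuc j} eq = contradiction (sym eq) (x∉ j)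
  ι′-inj {fsuc i} {zero}   eq = contradiction eq (x∉ i)
  ι′-inj {fsuc i} {fsuc j} eq = cong fsuc (ι-inj eq)
...   | no ¬x = contradiction (finite-countable (λ a → just (ι a , _)) (λ {x} _ →
  let a , eq = decidable-stable em (λ ¬a → ¬x (x , λ a e → ¬a (a , e)))
  in a , MaybeAny.just eq)) unc

-- Encodings

module _ (N : Setoid c ℓ) (ι : A → Setoid.Carrier N) where
  open Setoid (HalfEdges N) using (_≈_) renaming (Carrier to Half)

  -- This is the relation under `Any` in `encodes-edge`, given a name so that it can be transported
  -- between readings of the same code.
  Joins : Half → Half → (A × Port) × (A × Port) → Set ℓ
  Joins x y (a , b) = (map₁ ι a ≈ x × map₁ ι b ≈ y) ⊎ (map₁ ι a ≈ y × map₁ ι b ≈ x)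

module _ (N : Setoid c ℓ) (ι : A → Setoid.Carrier N)
         (M : Setoid c′ ℓ′) (κ : A → Setoid.Carrier M) where
  private
    module N = Setoid N
    module M = Setoid M

  joins-map : ∀ {v w v′ w′ p q} →
              (∀ {a} → ι a N.≈ v → κ a M.≈ v′) → (∀ {a} → ι a N.≈ w → κ a M.≈ w′) →
              ∀ {e} → Joins N ι (v , p) (w , q) e → Joins M κ (v′ , p) (w′ , q) e
  joins-map f g = Sum.map (λ ((e , p) , (e′ , q)) → (f e , p) , (g e′ , q))
                          (λ ((e , p) , (e′ , q)) → (g e , p) , (f e′ , q))

module _ {N : Setoid c ℓ} {M : Setoid c′ ℓ′} {ι : A → Setoid.Carrier N} {κ : A → Setoid.Carrier M}
         {γ : GraphCode A} {G : PortGraph N} {H : PortGraph M} where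
  private
    module N = Setoid N
    module M = Setoid M

  -- The map `j` runs from the vertices of `H` back to those of `G` because renamed and induced
  -- graphs are preimages. Renaming, undoing a renaming and restriction to an induced subgraph are
  -- all instances.
  encodes-pull : (j : M.Carrier → N.Carrier) →
                 (∀ a v → ι a N.≈ j v Fun.⇔ κ a M.≈ v) →
                 (∀ v → vertex G (j v) Fun.⇔ vertex H v) →
                 (∀ x y → edge G (map₁ j x) (map₁ j y) Fun.⇔ edge H x y) →
                 Encodes ι γ G → Encodes κ γ H
  encodes-pull j near V E enc = record
    { encodes-vertex = λ v → mk⇔
        (ListAny.map (to (near _ v)) ∘ to (encodes-vertex enc (j v)) ∘ from (V v))
        (to (V v) ∘ from (encodes-vertex enc (j v)) ∘ ListAny.map (from (near _ v)))
    ; encodes-edge = λ x y → mk⇔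
        (ListAny.map (joins-map N ι M κ (to (near _ _)) (to (near _ _))) ∘
         to (encodes-edge enc (map₁ j x) (map₁ j y)) ∘ from (E x y))
        (to (E x y) ∘ from (encodes-edge enc (map₁ j x) (map₁ j y)) ∘
         ListAny.map (joins-map M κ N ι (from (near _ _)) (from (near _ _))))
    }

module _ {N : Setoid c ℓ} {ι : A → Setoid.Carrier N} {γ : GraphCode A}
         {G H : PortGraph N} where

  encodes-unique : Encodes ι γ G → Encodes ι γ H → G ≈ᴳ H
  encodes-unique g h =
    ( (λ {v} → from (encodes-vertex h v) ∘ to (encodes-vertex g v))
    , (λ {v} → from (encodes-vertex g v) ∘ to (encodes-vertex h v)) )
    , ( (λ {x y} → from (encodes-edge h x y) ∘ to (encodes-edge g x y))
      , (λ {x y} → from (encodes-edge g x y) ∘ to (encodes-edge h x y)) )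

  encodes-resp : {κ : A → Setoid.Carrier N} → (∀ a → Setoid._≈_ N (ι a) (κ a)) →
                 G ≈ᴳ H → Encodes ι γ G → Encodes κ γ H
  encodes-resp eq ((V , V′) , (E , E′)) = encodes-pull id
    (λ a v → mk⇔ (N.trans (N.sym (eq a))) (N.trans (eq a)))
    (λ v → mk⇔ V V′) (λ x y → mk⇔ E E′)
    where module N = Setoid N

encodes-rename : {N : Setoid c ℓ} {M : Setoid c′ ℓ′} (R : Inverse N M)
                 {ι : A → Setoid.Carrier N} {γ : GraphCode A} {G : PortGraph N} →
                 Encodes ι γ G → Encodes (Inverse.to R ∘ ι) γ (renamePortGraph R G)
encodes-rename R = encodes-pull R.from
  (λ a v → mk⇔ R.inverseˡ (N.sym ∘ R.inverseʳ ∘ M.sym))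
  (λ v → mk⇔ id id) (λ x y → mk⇔ id id)
  where
  module R = Inverse R
  module N = Setoid R.Eq₁.setoid
  module M = Setoid R.Eq₂.setoid

encodes-unrename : (R : A ↔ A) {ι : B → A} {γ : GraphCode B} {G : PortGraph (Vₛ A)} →
                   Encodes ι γ (renamePortGraph R G) → Encodes (Inverse.from R ∘ ι) γ G
encodes-unrename R {G = G} = encodes-pull R.to
  (λ a v → mk⇔ R.inverseʳ (sym ∘ R.inverseˡ ∘ sym))
  (λ v → mk⇔ (subst (vertex G) (R.strictlyInverseʳ v))
             (subst (vertex G) (sym (R.strictlyInverseʳ v))))
  (λ x y → mk⇔ (subst₂ (edge G) (back x) (back y))
               (subst₂ (edge G) (sym (back x)) (sym (back y))))
  where
  module R = Inverse R

  back : ∀ x → map₁ R.from (map₁ R.to x) ≡ x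
  back (v , p) = cong (_, p) (R.strictlyInverseʳ v)

-- Induced subgraphs

-- Up to `ι`, the graph `g` is the subgraph of `G` induced by the range of `ι`: edges are reflected
-- as well as preserved. Points of `A` need not be vertices.
record Embedding (ι : A → B) (g : PortGraph (Vₛ A)) (G : PortGraph (Vₛ B)) : Set where
  field
    ι-injective : Injective _≡_ _≡_ ι
    vertex-⇔    : ∀ a → vertex G (ι a) Fun.⇔ vertex g a
    edge-⇔      : ∀ x y → edge G (map₁ ι x) (map₁ ι y) Fun.⇔ edge g x y

module _ {G : PortGraph (Vₛ A)} where

  within-weaken : ∀ {m n u v} → m ≤ n → Within G m u v → Within G n u v
  within-weaken _         here       = here
  within-weaken (s≤s m≤n) (step e w) = step e (within-weaken m≤n w)

  within-snoc : ∀ {n u v w k l} → Within G n u v → edge G (v , k) (w , l) →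
                Within G (suc n) u w
  within-snoc here       e = step e here
  within-snoc (step d w) e = step d (within-snoc w e)

  edge-vertex′ : ∀ {x y} → edge G x y → vertex G (proj₁ y)
  edge-vertex′ = edge-vertex G ∘ edge-sym G

module _ {ι : A → B} {g : PortGraph (Vₛ A)} {G : PortGraph (Vₛ B)}
         (emb : Embedding ι g G) where
  open Embedding emb

  within-push : ∀ {n u v} → Within g n u v → Within G n (ι u) (ι v)
  within-push here       = here
  within-push (step e w) = step (from (edge-⇔ _ _) e) (within-push w)

  module _ {r c} (covers : ∀ {v} → vertex G v → Within G r (ι c) v → ∃[ a ] ι a ≡ v) where

    -- The first m steps are remembered so that every vertex met on the way is
    -- known to lie in the ball, hence in the image of ι.

    within-pull-from : ∀ m {n a x u v} → m + n ≡ r → Within G m (ι c) (ι a) →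
                       u ≡ ι a → v ≡ ι x → Within G n u v → Within g n a x
    within-pull-from m eq c~a refl v≡ here with refl ← ι-injective v≡ = here
    within-pull-from m {suc n} eq c~a refl v≡ (step {w = w} e rest)
      with covers (edge-vertex′ {G = G} e)
             (within-weaken (ℕ.≤-trans (s≤s (ℕ.m≤m+n m n))
                              (ℕ.≤-reflexive (trans (sym (ℕ.+-suc m n)) eq)))
               (within-snoc c~a e))
    ... | a′ , refl = step (to (edge-⇔ _ _) e)
      (within-pull-from (suc m) (trans (sym (ℕ.+-suc m n)) eq)
        (within-snoc c~a e) refl v≡ rest)

    within-pull : ∀ {x} → Within G r (ι c) (ι x) → Within g r c x
    within-pull = within-pull-from 0 refl here refl refl

    -- Since the range of `ι` contains the ball of `G` around `ι c`, a walk of length at most `r`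
    -- from that centre never leaves the range and is therefore a walk of `g`. Both graphs thus have
    -- the same ball.
    ball-embedding : Embedding ι (proj₁ (ball r g c)) (proj₁ (ball r G (ι c)))
    ball-embedding = record
      { ι-injective = ι-injective
      ; vertex-⇔ = λ a → mk⇔
          (λ (v , w) → to (vertex-⇔ a) v , within-pull w)
          (λ (v , w) → from (vertex-⇔ a) v , within-push w)
      ; edge-⇔ = λ x y → mk⇔
          (λ (e , w , w′) → to (edge-⇔ x y) e , within-pull w , within-pull w′)
          (λ (e , w , w′) → from (edge-⇔ x y) e , within-push w , within-push w′)
      }

  module _ {σ : C → A} {τ : C → B} (τ≗ισ : ∀ i → τ i ≡ ι (σ i)) {γ : GraphCode C} where

    encodes-restrict : Encodes τ γ G → Encodes σ γ g
    encodes-restrict = encodes-pull ι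
      (λ i v → mk⇔ (λ e → ι-injective (trans (sym (τ≗ισ i)) e))
                   (λ { refl → τ≗ισ i }))
      vertex-⇔ edge-⇔

    -- This is no instance of `encodes-pull`, as `ι` has no inverse defined on all of `B`. A
    -- preimage is instead found case by case: `covers` gives it for vertices of `G`, and `τ≗ισ` for
    -- vertices that the code mentions.
    encodes-extend : (∀ {v} → vertex G v → ∃[ a ] ι a ≡ v) →
                     Encodes σ γ g → Encodes τ γ G
    encodes-extend covers enc = record
      { encodes-vertex = λ v → mk⇔
          (λ v∈G → vertex-to v∈G (covers v∈G))
          (λ v∈γ → vertex-from v∈γ (proj₂ (ListAny.satisfied v∈γ)))
      ; encodes-edge = λ x y → mk⇔
          (λ e → edge-to e (covers (edge-vertex G e)) (covers (edge-vertex′ {G = G} e)))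
          (λ e∈γ → edge-from e∈γ (proj₂ (ListAny.satisfied e∈γ)))
      }
      where
      to-τ : ∀ {a i} → σ i ≡ a → τ i ≡ ι a
      to-τ refl = τ≗ισ _

      to-σ : ∀ {a i} → τ i ≡ ι a → σ i ≡ a
      to-σ e = ι-injective (trans (sym (τ≗ισ _)) e)

      vertex-to : ∀ {v} → vertex G v → (∃[ a ] ι a ≡ v) →
                  Any (λ i → τ i ≡ v) (vertices γ)
      vertex-to v∈G (a , refl) = ListAny.map to-τ
        (to (encodes-vertex enc a) (to (vertex-⇔ a) v∈G))

      vertex-from : ∀ {v i} → Any (λ i → τ i ≡ v) (vertices γ) → τ i ≡ v → vertex G v
      vertex-from {i = i} v∈γ refl =
        subst (vertex G) (sym (τ≗ισ i)) (from (vertex-⇔ (σ i)) (from (encodes-vertex enc (σ i))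
          (ListAny.map (λ e → to-σ (trans e (τ≗ισ i))) v∈γ)))

      edge-to : ∀ {x y} → edge G x y → (∃[ a ] ι a ≡ proj₁ x) → (∃[ a ] ι a ≡ proj₁ y) →
                Any (Joins (Vₛ B) τ x y) (edges γ)
      edge-to {_ , p} {_ , q} e (a , refl) (a′ , refl) =
        ListAny.map (joins-map (Vₛ A) σ (Vₛ B) τ to-τ to-τ)
          (to (encodes-edge enc (a , p) (a′ , q)) (to (edge-⇔ _ _) e))

      edge-from-ι : ∀ {a a′ v w p q} → Any (Joins (Vₛ B) τ (v , p) (w , q)) (edges γ) →
                    v ≡ ι a → w ≡ ι a′ → edge G (v , p) (w , q)
      edge-from-ι e∈γ refl refl =
        from (edge-⇔ _ _) (from (encodes-edge enc _ _)
          (ListAny.map (joins-map (Vₛ B) τ (Vₛ A) σ to-σ to-σ) e∈γ))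

      edge-from : ∀ {x y e} → Any (Joins (Vₛ B) τ x y) (edges γ) →
                  Joins (Vₛ B) τ x y e → edge G x y
      edge-from e∈γ (inj₁ ((refl , _) , (refl , _))) = edge-from-ι e∈γ (τ≗ισ _) (τ≗ισ _)
      edge-from e∈γ (inj₂ ((refl , _) , (refl , _))) = edge-from-ι e∈γ (τ≗ισ _) (τ≗ισ _)

-- This is how `encodes-image` reads the code of a vertex name, for an arbitrary placement `σ` in
-- the role of `naming`.
name : (A → B) → List (A × C) → Pred (B × C) 0ℓ
name σ l x = x ∈ List.map (map₁ σ) l

module _ {ι : B → V} {σ : A → B} {τ : A → V} (τ≗ισ : ∀ i → τ i ≡ ι (σ i)) where

  name-map : (l : List (A × C)) → List.map (map₁ τ) l ≡ List.map (map₁ ι) (List.map (map₁ σ) l)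
  name-map l = trans (List.map-cong (λ (i , c) → cong (_, c) (τ≗ισ i)) l) (List.map-∘ l)

module _ (ι : B → V) {A A′ C : Set} {σ : A → B} {τ : A → V} {σ′ : A′ → B} {τ′ : A′ → V}
         (τ≗ισ : ∀ i → τ i ≡ ι (σ i)) (τ′≗ισ′ : ∀ i → τ′ i ≡ ι (σ′ i))
         {l : List (A × C)} {l′ : List (A′ × C)} where

  name-⊆-push : name σ l ⊆ name σ′ l′ → name τ l ⊆ name τ′ l′
  name-⊆-push sub {x} x∈
    with y , y∈ , refl ← ∈-map⁻ (map₁ ι) (subst (x ∈_) (name-map τ≗ισ l) x∈) =
    subst (x ∈_) (sym (name-map τ′≗ισ′ l′)) (∈-map⁺ (map₁ ι) (sub y∈))

  -- Injectivity keeps distinct points of `B` apart in `V`, so comparing names after applying `ι`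
  -- loses nothing.
  name-⊆-pull : Injective _≡_ _≡_ ι → name τ l ⊆ name τ′ l′ → name σ l ⊆ name σ′ l′
  name-⊆-pull inj sub {x} x∈
    with y , y∈ , eq ← ∈-map⁻ (map₁ ι) (subst (map₁ ι x ∈_) (name-map τ′≗ισ′ l′)
           (sub (subst (map₁ ι x ∈_) (sym (name-map τ≗ισ l)) (∈-map⁺ (map₁ ι) x∈)))) =
    subst (_∈ List.map (map₁ σ′) l′)
      (cong₂ _,_ (inj (sym (cong proj₁ eq))) (sym (cong proj₂ eq))) y∈

-- Words and prefixes of paths

module _ {n} {w w′ : Word n} (w≗w′ : w ≗ w′) where

  monotonous-resp : Monotonous w → Monotonous w′
  monotonous-resp mono i (j , k , j≡ , k≡ , alt) = mono i (j , k , j≡ , k≡ , back alt)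
    where
    back : (p w′ i ≡ q w′ j ⁺ × p w′ j ≡ q w′ k ⁻) ⊎ (p w′ i ≡ q w′ j ⁻ × p w′ j ≡ q w′ k ⁺) →
           (p w i ≡ q w j ⁺ × p w j ≡ q w k ⁻) ⊎ (p w i ≡ q w j ⁻ × p w j ≡ q w k ⁺)
    back alt rewrite w≗w′ i | w≗w′ j | w≗w′ k = alt

  path-resp : {N : Setoid c ℓ} {G : PortGraph N} → IsPath w G → IsPath w′ G
  path-resp {G = G} (v , v∈G , e) = v , v∈G , λ i →
    subst (λ l → edge G (v (inject₁ i) , proj₁ l) (v (fsuc i) , proj₂ l)) (w≗w′ i) (e i)

module _ {m n} (m≤n : m ≤ n) (w : Word n) where

  prefix : Word m
  prefix i = w (inject≤ i m≤n)

  prefix-monotonous : Monotonous w → Monotonous prefix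
  prefix-monotonous mono i (j , k , j≡ , k≡ , alt) =
    mono (inject≤ i m≤n) (inject≤ j m≤n , inject≤ k m≤n , shift 1 j j≡ , shift 2 k k≡ , alt)
    where
    shift : ∀ d j → toℕ j ≡ d + toℕ i → toℕ (inject≤ j m≤n) ≡ d + toℕ (inject≤ i m≤n)
    shift d j eq = trans (Fin.toℕ-inject≤ j m≤n)
      (trans eq (cong (d +_) (sym (Fin.toℕ-inject≤ i m≤n))))

  prefix-path : {N : Setoid c ℓ} {G : PortGraph N} → IsPath w G → IsPath prefix G
  prefix-path {G = G} (v , v∈G , e) =
    (λ i → v (inject≤ i (s≤s m≤n))) , (λ i → v∈G _) , λ i →
      subst (λ j → edge G (v j , q prefix i) (v (fsuc (inject≤ i m≤n)) , p prefix i))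
        -- Shortening and then injecting a position agrees with injecting and then shortening it:
        -- both leave the number `toℕ i`.
        (Fin.toℕ-injective (trans (Fin.toℕ-inject₁ _) (trans (Fin.toℕ-inject≤ i m≤n)
          (sym (trans (Fin.toℕ-inject≤ (inject₁ i) (s≤s m≤n)) (Fin.toℕ-inject₁ i))))))
        (e (inject≤ i m≤n))

-- Prefixes of monotonous paths are monotonous, so a graph violates the bound `s` only if it has a
-- monotonous path of length exactly `s + 1`. Fixing the length makes the search finite.
LongPath : {N : Setoid c ℓ} → PortGraph N → ℕ → Set c
LongPath G s = Σ[ ws ∈ Vec (Port × Port) (suc s) ] IsPath (lookup ws) G × Monotonous (lookup ws)

module _ {N : Setoid c ℓ} {G : Graph N} where

  ¬longPath⇒boundedStar : ¬ LongPath (portGraph G) s → BoundedStar G s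
  ¬longPath⇒boundedStar ¬long w path mono = ℕ.≮⇒≥ λ s<n → ¬long
    ( tabulate (prefix s<n w)
    , path-resp (sym ∘ Vec.lookup∘tabulate _) {G = portGraph G}
        (prefix-path s<n w {G = portGraph G} path)
    , monotonous-resp (sym ∘ Vec.lookup∘tabulate _) (prefix-monotonous s<n w mono) )

  boundedStar⇒¬longPath : BoundedStar G s → ¬ LongPath (portGraph G) s
  boundedStar⇒¬longPath bounded (ws , path , mono) =
    ℕ.<-irrefl refl (bounded (lookup ws) path mono)

-- Paths in the image, as chains of placed rows

module _ (_≟_ : DecidableEquality V) (f : LocalRule V r b) where
  open LocalRule f

  -- The injections `naming E` and `τ` differ by a bijection `R` of `V`. The renamed representative
  -- and `D` then have the same code read through `τ`, so they are equal as disks, and equivariance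
  -- carries the tabulated image to the value of `f` at `D`.
  encodes-value : {e : Entry b} → EntryOf f e → (D : Disk r) {τ : Fin (size e) → V} →
                  Injective _≡_ _≡_ τ → proj₂ (pointed D) ≡ τ (centre e) →
                  Encodes τ (disk e) (proj₁ (pointed D)) →
                  Encodes {N = Names V b} (name τ) (image e) (portGraph (apply D))
  encodes-value {e} E D {τ} τ-inj centre≡ enc =
    encodes-resp names
      (Setoid.trans (graphSetoid (Names V b)) {renameGraph (renameNames R b) (apply rep)}
        {apply (renameDisk R rep)} {apply D}
        (Setoid.sym (graphSetoid (Names V b)) {apply (renameDisk R rep)}
          {renameGraph (renameNames R b) (apply rep)} (equivariant R rep))
        (Func.cong rule {renameDisk R rep} {D} same))
      (encodes-rename (renameNames R b) (encodes-image E))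
    where
    rep = representative E
    ext = extendInjection _≟_ (naming E) τ (injective E) τ-inj
    R = proj₁ ext
    module R = Inverse R

    same : pointed (renameDisk R rep) ≈ᴾ pointed D
    same =
      encodes-unique (encodes-resp {H = renamePortGraph R (proj₁ (pointed rep))}
        (proj₂ ext) ((id , id) , (id , id)) (encodes-rename R (encodes-disk E))) enc ,
      trans (cong R.to (centre-named E)) (trans (proj₂ ext (centre e)) (sym centre≡))

    names : ∀ l → (λ x → map₁ R.from x ∈ List.map (map₁ (naming E)) l) ≐ name τ l
    names l =
      (λ {x} x∈ → subst₂ _∈_ (cong (_, proj₂ x) (R.strictlyInverseˡ (proj₁ x)))
        (sym (name-map (sym ∘ proj₂ ext) l)) (∈-map⁺ (map₁ R.to) x∈)) ,
      (λ {x} x∈ → let y , y∈ , eq = ∈-map⁻ (map₁ R.to)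
                        (subst (x ∈_) (name-map (sym ∘ proj₂ ext) l) x∈)
                  in subst (_∈ List.map (map₁ (naming E)) l)
                       (trans (sym (cong (_, proj₂ y) (R.strictlyInverseʳ (proj₁ y))))
                              (cong (map₁ R.from) (sym eq))) y∈)

-- An edge may be listed in one order and traversed by a path in the other.
orient : Bool → A × A → A × A
orient false = id
orient true  = swap

-- An edge of the image of a graph on A: the row of the table it comes from, the
-- placement of this row in A, and the position of the edge in the row's image.

record Move {b} (t : Table b) (A : Set) : Set where
  constructor move
  field
    index     : Fin (length t)
    placement : Vec A (size (List.lookup t index))
    edgeIndex : Fin (length (edges (image (List.lookup t index))))
    reversed  : Bool

open Move

module _ {b} {t : Table b} where

  mapMove : (A → B) → Move t A → Move t B
  mapMove ι (move k σ j flip) = move k (Vec.map ι σ) j flip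

  row : Move t A → Entry b
  row m = List.lookup t (index m)

  place : (m : Move t A) → Fin (size (row m)) → A
  place m = lookup (placement m)

  place-map : (ι : A → B) (m : Move t A) → ∀ i → place (mapMove ι m) i ≡ ι (place m i)
  place-map ι m i = Vec.lookup-map i ι (placement m)

  middle : Move t A → A
  middle m = place m (centre (row m))

  ends : (m : Move t A) → let X = List (Fin (size (row m)) × Fin (suc b)) × Port in X × X
  ends m = orient (reversed m) (List.lookup (edges (image (row m))) (edgeIndex m))

  source target : Move t A → Pred (A × Fin (suc b)) 0ℓ × Port
  source m = map₁ (name (place m)) (proj₁ (ends m))
  target m = map₁ (name (place m)) (proj₂ (ends m))

  word : (Fin n → Move t A) → Word n
  word ms i = proj₂ (source (ms i)) , proj₂ (target (ms i))

  -- When `A` is `V`, these are the conditions under which `encodes-value` identifies the value of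
  -- `f` at the disk with the row's image read through the placement.
  Fits : ℕ → PortGraph (Vₛ A) → Move t A → Set
  Fits r G m =
    Injective _≡_ _≡_ (place m) × vertex G (middle m) ×
    Encodes (place m) (disk (row m)) (proj₁ (ball r G (middle m)))

  -- This stands for a monotonous path of length `s + 1` in the image of `G`, expressed through the
  -- table alone, so that it makes sense on `Fin k` where `f` is not defined.
  Chain : ℕ → PortGraph (Vₛ A) → (Fin (suc s) → Move t A) → Set
  Chain r G ms =
    (∀ i → Fits r G (ms i)) ×
    (∀ i → proj₁ (target (ms (inject₁ i))) ≐ proj₁ (source (ms (fsuc i)))) ×
    Monotonous (word ms)

  chain-resp : {G : PortGraph (Vₛ A)} {ms ms′ : Fin (suc s) → Move t A} → ms ≗ ms′ →
               Chain r G ms → Chain r G ms′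
  chain-resp eq (fits , joined , mono) =
    (λ i → subst (Fits _ _) (eq i) (fits i)) ,
    (λ i → subst₂ (λ m m′ → proj₁ (target m) ≐ proj₁ (source m′))
             (eq (inject₁ i)) (eq (fsuc i)) (joined i)) ,
    monotonous-resp (λ i → cong (λ m → proj₂ (source m) , proj₂ (target m)) (eq i)) mono

  module _ {ι : A → B} {g : PortGraph (Vₛ A)} {G : PortGraph (Vₛ B)} (emb : Embedding ι g G) where
    open Embedding emb

    fits-push : (∀ {v} → vertex G v → ∃[ a ] ι a ≡ v) → ∀ m → Fits r g m → Fits r G (mapMove ι m)
    fits-push {r} covers m (inj , mid∈g , enc) =
      (λ {i} {j} eq → inj (ι-injective (trans (sym (place-map ι m i)) (trans eq (place-map ι m j))))) ,
      subst (vertex G) (sym mid≡) (from (vertex-⇔ _) mid∈g) ,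
      subst (λ c → Encodes (place (mapMove ι m)) (disk (row m)) (proj₁ (ball r G c))) (sym mid≡)
        (encodes-extend (ball-embedding emb (λ v∈G _ → covers v∈G)) (place-map ι m)
          (covers ∘ proj₁) enc)
      where mid≡ = place-map ι m (centre (row m))

    -- In contrast to `fits-push`, the range of `ι` need not contain all of `G`. It contains the
    -- disk at the centre of the move, and that suffices for `ball-embedding`.
    fits-pull : ∀ m → Fits r G (mapMove ι m) → Fits r g m
    fits-pull {r} m (inj , mid∈G , enc) =
      (λ {i} {j} eq → inj (trans (place-map ι m i) (trans (cong ι eq) (sym (place-map ι m j))))) ,
      to (vertex-⇔ _) (subst (vertex G) mid≡ mid∈G) ,
      encodes-restrict (ball-embedding emb covers) (place-map ι m) enc′
      where
      mid≡ = place-map ι m (centre (row m))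

      enc′ : Encodes (place (mapMove ι m)) (disk (row m)) (proj₁ (ball r G (ι (middle m))))
      enc′ = subst (λ c → Encodes (place (mapMove ι m)) (disk (row m)) (proj₁ (ball r G c))) mid≡ enc

      -- The row lists every vertex of the ball, so each of them is a placed point, and placed
      -- points lie in the range of `ι`.
      covers : ∀ {v} → vertex G v → Within G r (ι (middle m)) v → ∃[ a ] ι a ≡ v
      covers v∈G w =
        let i , e = ListAny.satisfied (to (encodes-vertex enc′ _) (v∈G , w))
        in place m i , trans (sym (place-map ι m i)) e

    chain-push : (∀ {v} → vertex G v → ∃[ a ] ι a ≡ v) → {ms : Fin (suc s) → Move t A} →
                 Chain r g ms → Chain r G (mapMove ι ∘ ms)
    chain-push covers {ms} (fits , joined , mono) =
      (λ i → fits-push covers (ms i) (fits i)) ,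
      (λ i → let m = ms (inject₁ i) ; m′ = ms (fsuc i) in
        name-⊆-push ι (place-map ι m) (place-map ι m′) (proj₁ (joined i)) ,
        name-⊆-push ι (place-map ι m′) (place-map ι m) (proj₂ (joined i))) ,
      mono

    chain-pull : {ms : Fin (suc s) → Move t A} → Chain r G (mapMove ι ∘ ms) → Chain r g ms
    chain-pull {ms = ms} (fits , joined , mono) =
      (λ i → fits-pull (ms i) (fits i)) ,
      (λ i → let m = ms (inject₁ i) ; m′ = ms (fsuc i) in
        name-⊆-pull ι (place-map ι m) (place-map ι m′) ι-injective (proj₁ (joined i)) ,
        name-⊆-pull ι (place-map ι m′) (place-map ι m) ι-injective (proj₂ (joined i))) ,
      mono

  liftMove : (ι : A → B) (m : Move t B) → (∀ i → ∃[ a ] ι a ≡ place m i) →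
             ∃[ m′ ] mapMove ι m′ ≡ m
  liftMove ι (move k σ j flip) covered =
    let ρ , ρ-spec = vec-choice covered in
    move k ρ j flip , cong (λ σ → move k σ j flip)
      (lookup-ext (λ i → trans (Vec.lookup-map i ι ρ) (ρ-spec i)))

-- Number of vertices involved in a chain

maxPlaces : Table b → ℕ
-- Any common bound on the sizes serves; the sum is at least each of them.
maxPlaces t = sum (List.map size t)

size≤maxPlaces : (t : Table b) → ∀ k → size (List.lookup t k) ≤ maxPlaces t
size≤maxPlaces (e ∷ t) zero     = ℕ.m≤m+n _ _
size≤maxPlaces (e ∷ t) (fsuc k) = ℕ.≤-trans (size≤maxPlaces t k) (ℕ.m≤n+m _ _)

places : (t : Table b) (ms : Fin n → Move t A) →
         ∃[ xs ] length xs ≤ n * maxPlaces t × (∀ i a → place (ms i) a ∈ xs)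
places {n = zero}  t ms = [] , z≤n , λ ()
places {n = suc n} t ms =
  let xs , len , mem = places t (ms ∘ fsuc)
      σ = placement (ms zero)
  in Vec.toList σ ++ xs ,
     ℕ.≤-trans
       (ℕ.≤-reflexive (trans (List.length-++ (Vec.toList σ))
         (cong (_+ length xs) (Vec.length-toList σ))))
       (ℕ.+-mono-≤ (size≤maxPlaces t (index (ms zero))) len) ,
     λ { zero a → ∈-++⁺ˡ (Vec∈.∈-toList⁺ (Vec∈.∈-lookup a σ))
       ; (fsuc i) a → ∈-++⁺ʳ (Vec.toList σ) (mem i a) }

-- Correspondence between edges of the dynamics and fitting moves

module _ {f : LocalRule V r b} {t : Table b} (tab : Tabulates f t) where

  -- The table supplies a bijection `R` that renames `D` into a representative; the placement is the
  -- naming of that representative followed by the inverse of `R`.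
  place-disk : (D : Disk r) → let eₖ = List.lookup t in
    ∃[ k ] Σ[ σ ∈ Vec V (size (eₖ k)) ]
      Injective _≡_ _≡_ (lookup σ) × proj₂ (pointed D) ≡ lookup σ (centre (eₖ k)) ×
      Encodes (lookup σ) (disk (eₖ k)) (proj₁ (pointed D))
  place-disk D with proj₂ tab D
  ... | k , (R , eqG , eqc) , _ = k , tabulate τ ,
    (λ {i} {j} eq → injective E (Injection.injective (↔⇒↣ (↔-sym R))
      (trans (sym (σ≗τ i)) (trans eq (σ≗τ j))))) ,
    trans (sym (R.strictlyInverseʳ _)) (trans (cong R.from (trans eqc (centre-named E)))
      (sym (σ≗τ _))) ,
    encodes-resp {G = proj₁ (pointed D)} {H = proj₁ (pointed D)} (sym ∘ σ≗τ) ((id , id) , (id , id))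
      (encodes-unrename R {G = proj₁ (pointed D)}
        (encodes-resp {G = proj₁ (pointed (representative E))}
          {H = renamePortGraph R (proj₁ (pointed D))} (λ _ → refl)
          ((proj₂ (proj₁ eqG) , proj₁ (proj₁ eqG)) , (proj₂ (proj₂ eqG) , proj₁ (proj₂ eqG)))
          (encodes-disk E)))
    where
    module R = Inverse R
    E = proj₁ tab k
    τ = R.from ∘ naming E

    σ≗τ : lookup (tabulate τ) ≗ τ
    σ≗τ = Vec.lookup∘tabulate τ

module _ {t : Table b} {H : PortGraph (Vₛ V)} {w : Word (suc s)}
         {v : Fin (suc (suc s)) → Pred (V × Fin (suc b)) 0ℓ} where
  open Setoid (HalfEdges (Names V b)) using () renaming (_≈_ to _≈ʰ_)

  -- Consecutive moves join because the target of one and the source of the next both equal the same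
  -- vertex of the path.
  chain-of-moves : (∀ i → Σ[ m ∈ Move t V ] Fits r H m ×
                     source m ≈ʰ (v (inject₁ i) , q w i) × target m ≈ʰ (v (fsuc i) , p w i)) →
                   Monotonous w → Σ[ ms ∈ (Fin (suc s) → Move t V) ] Chain r H ms
  chain-of-moves found mono =
    proj₁ ∘ found , proj₁ ∘ proj₂ ∘ found ,
    (λ i → ≐-trans (proj₁ (to-v (inject₁ i))) (≐-sym (proj₁ (from-v (fsuc i))))) ,
    monotonous-resp (λ i → cong₂ _,_ (sym (proj₂ (from-v i))) (sym (proj₂ (to-v i)))) mono
    where
    from-v : ∀ i → source (proj₁ (found i)) ≈ʰ (v (inject₁ i) , q w i)
    from-v i = proj₁ (proj₂ (proj₂ (found i)))

    to-v : ∀ i → target (proj₁ (found i)) ≈ʰ (v (fsuc i) , p w i)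
    to-v i = proj₂ (proj₂ (proj₂ (found i)))

module _ (_≟_ : DecidableEquality V) (f : LocalRule V r b) {t : Table b} (tab : Tabulates f t)
         (G : Graph (Vₛ V)) where
  open LocalRule f
  open Setoid (HalfEdges (Names V b)) using () renaming (_≈_ to _≈ʰ_)

  private
    H = portGraph G
    F = portGraph (dynamics f G)

  edge-of-move : (m : Move t V) → Fits r H m → edge F (source m) (target m)
  edge-of-move m (inj , mid∈G , enc) =
    middle m , mid∈G ,
    from (encodes-edge (encodes-value _≟_ f (proj₁ tab (index m))
           (diskAt r G (middle m) mid∈G) inj refl enc) _ _)
      (lose (∈-lookup (edgeIndex m)) (joins (reversed m)))
    where
    joins : ∀ flip → let x , y = orient flip (List.lookup (edges (image (row m))) (edgeIndex m))
                         σ = map₁ (name (place m))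
                     in Joins (Names V b) (name (place m)) (σ x) (σ y)
                          (List.lookup (edges (image (row m))) (edgeIndex m))
    joins false = inj₁ ((≐-refl , refl) , (≐-refl , refl))
    joins true  = inj₂ ((≐-refl , refl) , (≐-refl , refl))

  ¬bounded-of-chain : {ms : Fin (suc s) → Move t V} → Chain r H ms →
                      ¬ BoundedStar (dynamics f G) s
  ¬bounded-of-chain {s = s} {ms} (fits , joined , mono) bounded =
    ℕ.<-irrefl refl (bounded (word ms) (v , v∈F , v-edge) mono)
    where
    v : Fin (suc (suc s)) → Pred (V × Fin (suc b)) 0ℓ
    v zero     = proj₁ (source (ms zero))
    v (fsuc i) = proj₁ (target (ms i))

    -- A vertex inside the path is the target of one move and the source of the next. These are two
    -- descriptions of one set, equal only extensionally.
    source≐v : ∀ i → proj₁ (source (ms i)) ≐ v (inject₁ i)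
    source≐v zero     = ≐-refl
    source≐v (fsuc i) = ≐-sym (joined i)

    move-edge : ∀ i → edge F (source (ms i)) (target (ms i))
    move-edge i = edge-of-move (ms i) (fits i)

    v∈F : ∀ i → vertex F (v i)
    v∈F zero     = edge-vertex F (move-edge zero)
    v∈F (fsuc i) = edge-vertex F (edge-sym F {source (ms i)} (move-edge i))

    v-edge : ∀ i → edge F (v (inject₁ i) , q (word ms) i) (v (fsuc i) , p (word ms) i)
    v-edge i = proj₂ (edge-resp F) {target (ms i)} (source≐v i , refl) (move-edge i)

  oriented : ∀ {τ : A → V} {x y e} → Joins (Names V b) (name τ) x y e →
             ∃[ flip ] map₁ (name τ) (proj₁ (orient flip e)) ≈ʰ x ×
                       map₁ (name τ) (proj₂ (orient flip e)) ≈ʰ y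
  oriented (inj₁ (h , h′)) = false , h , h′
  oriented (inj₂ (h , h′)) = true , h′ , h

  -- An edge of the union comes from the image of one disk; the row placed on that disk lists the
  -- edge in one of its two orders.
  move-of-edge : ∀ {x y} → edge F x y →
                 Σ[ m ∈ Move t V ] Fits r H m × source m ≈ʰ x × target m ≈ʰ y
  move-of-edge {x} {y} (u , u∈G , e)
    with k , σ , inj , mid≡ , enc ← place-disk {f = f} {t = t} tab (diskAt r G u u∈G) =
    orientMove (to (encodes-edge
      (encodes-value _≟_ f (proj₁ tab k) (diskAt r G u u∈G) inj mid≡ enc) x y) e)
    where
    eₖ = List.lookup t k

    orientMove : Any (Joins (Names V b) (name (lookup σ)) x y) (edges (image eₖ)) →
                 Σ[ m ∈ Move t V ] Fits r H m × source m ≈ʰ x × target m ≈ʰ y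
    orientMove e∈image
      with flip , ends≈ ← oriented {τ = lookup σ} {x = x} {y = y}
             (ListAny.lookup-index {P = Joins (Names V b) (name (lookup σ)) x y} e∈image) =
      move k σ (ListAny.index e∈image) flip ,
      (inj , subst (vertex H) mid≡ u∈G ,
       subst (λ c → Encodes (lookup σ) (disk eₖ) (proj₁ (ball r H c))) mid≡ enc) ,
      ends≈

  chain-of-path : LongPath F s → Σ[ ms ∈ (Fin (suc s) → Move t V) ] Chain r H ms
  chain-of-path (ws , (v , _ , v-edge) , mono) =
    chain-of-moves {w = lookup ws} {v = v} (λ i → move-of-edge (v-edge i)) mono

-- Decision procedures on finite graphs

module _ {k} {G : PortGraph (Vₛ (Fin k))} where

  path? : (∀ a → Dec (vertex G a)) → (∀ x y → Dec (edge G x y)) →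
          (w : Word n) → Dec (IsPath w G)
  path? {n} vertex? edge? w = map′
    (λ (vs , h) → lookup vs , h)
    (λ (v , v∈G , e) → let v≡ = sym ∘ Vec.lookup∘tabulate v in
      tabulate v , (λ i → subst (vertex G) (v≡ i) (v∈G i)) ,
      λ i → subst₂ (λ x y → edge G (x , q w i) (y , p w i)) (v≡ (inject₁ i)) (v≡ (fsuc i)) (e i))
    (search-Vec Fin.any? (suc n) λ vs →
      Fin.all? (λ i → vertex? (lookup vs i)) ×-dec
      Fin.all? (λ i → edge? (lookup vs (inject₁ i) , q w i) (lookup vs (fsuc i) , p w i)))

  within? : (∀ x y → Dec (edge G x y)) → ∀ n u v → Dec (Within G n u v)
  within? edge? zero u v = map′ (λ { refl → here }) (λ { here → refl }) (u Fin.≟ v)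
  within? edge? (suc n) u v = map′
    (λ { (inj₁ refl) → here ; (inj₂ (w , _ , _ , e , rest)) → step e rest })
    (λ { here → inj₁ refl ; (step e rest) → inj₂ (_ , _ , _ , e , rest) })
    (u Fin.≟ v ⊎-dec Fin.any? λ w → Fin.any? λ i → Fin.any? λ j →
      edge? (u , i) (w , j) ×-dec within? edge? n w v)

  encodes? : (∀ a → Dec (vertex G a)) → (∀ x y → Dec (edge G x y)) →
             (σ : A → Fin k) (γ : GraphCode A) → Dec (Encodes σ γ G)
  encodes? vertex? edge? σ γ = map′
    (λ (V , E) → record { encodes-vertex = V ; encodes-edge = λ (v , i) (w , j) → E v i w j })
    (λ enc → encodes-vertex enc , λ v i w j → encodes-edge enc (v , i) (w , j))
    (Fin.all? (λ v → vertex? v ⇔-dec ListAny.any? (λ a → σ a Fin.≟ v) (vertices γ))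
     ×-dec
     Fin.all? λ v → Fin.all? λ i → Fin.all? λ w → Fin.all? λ j →
       edge? (v , i) (w , j) ⇔-dec
       ListAny.any? (λ ((a , i′) , (a′ , j′)) →
         ((σ a Fin.≟ v ×-dec i′ Fin.≟ i) ×-dec (σ a′ Fin.≟ w ×-dec j′ Fin.≟ j)) ⊎-dec
         ((σ a Fin.≟ w ×-dec i′ Fin.≟ j) ×-dec (σ a′ Fin.≟ v ×-dec j′ Fin.≟ i))) (edges γ))

monotonous? : (w : Word n) → Dec (Monotonous w)
monotonous? w = Fin.all? λ i → ¬? (Fin.any? λ j → Fin.any? λ k →
  (toℕ j ℕ.≟ 1 + toℕ i) ×-dec (toℕ k ℕ.≟ 2 + toℕ i) ×-dec
  ((p w i Fin.≟ q w j ⁺ ×-dec p w j Fin.≟ q w k ⁻) ⊎-dec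
   (p w i Fin.≟ q w j ⁻ ×-dec p w j Fin.≟ q w k ⁺)))

name-⊆? : {A A′ : Set} (σ : A → Fin k) (l : List (A × Fin n))
          (σ′ : A′ → Fin k) (l′ : List (A′ × Fin n)) →
          Dec (name σ l ⊆ name σ′ l′)
name-⊆? σ l σ′ l′ = map′ (λ h {x} → h x) (λ h x → h {x})
  (forall? (search-× Fin.any? Fin.any?) λ x → (x ∈? _) →-dec (x ∈? _))
  where
  _∈?_ : ∀ x xs → Dec (x ∈ xs)
  x ∈? xs = ListAny.any? (Product.≡-dec Fin._≟_ Fin._≟_ x) xs

injective? : (σ : Fin n → Fin k) → Dec (Injective _≡_ _≡_ σ)
injective? σ = map′ (λ h {i} {j} → h i j) (λ h i j → h {i} {j})
  (Fin.all? λ i → Fin.all? λ j → (σ i Fin.≟ σ j) →-dec (i Fin.≟ j))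

search-Move : (t : Table b) → Searchable A → Searchable (Move t A)
search-Move t sA P? = map′
  (λ ((k , σ , j , flip) , p) → move k σ j flip , p)
  (λ (move k σ j flip , p) → (k , σ , j , flip) , p)
  (search-Σ Fin.any? (λ k → search-× (search-Vec sA _) (search-× Fin.any? search-Bool))
    λ (k , σ , j , flip) → P? (move k σ j flip))

module _ {k} {G : PortGraph (Vₛ (Fin k))}
         (vertex? : ∀ a → Dec (vertex G a)) (edge? : ∀ x y → Dec (edge G x y)) where

  longPath? : ∀ s → Dec (LongPath G s)
  longPath? s = search-Vec (search-× Fin.any? Fin.any?) (suc s) λ ws →
    path? {G = G} vertex? edge? (lookup ws) ×-dec monotonous? (lookup ws)

  module _ {t : Table b} where

    fits? : ∀ r m → Dec (Fits {t = t} r G m)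
    fits? r m = injective? (place m) ×-dec vertex? (middle m) ×-dec
      encodes? {G = proj₁ (ball r G (middle m))}
        (λ a → vertex? a ×-dec inBall a)
        (λ x y → edge? x y ×-dec inBall (proj₁ x) ×-dec inBall (proj₁ y))
        (place m) (disk (row m))
      where inBall = within? {G = G} edge? r (middle m)

    chain? : ∀ r (ms : Fin (suc s) → Move t (Fin k)) → Dec (Chain r G ms)
    chain? r ms =
      Fin.all? (λ i → fits? r (ms i)) ×-dec
      Fin.all? (λ i →
        let m = ms (inject₁ i) ; m′ = ms (fsuc i)
            l = proj₁ (proj₂ (ends m)) ; l′ = proj₁ (proj₁ (ends m′)) in
        name-⊆? (place m) l (place m′) l′ ×-dec name-⊆? (place m′) l′ (place m) l) ×-dec
      monotonous? (word ms)

-- Finite graphs as searchable bit patterns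

BitGraph : ℕ → Set
BitGraph k = Vec Bool k × Vec (Vec (Vec (Vec Bool 3) k) 3) k

search-BitGraph : ∀ k → Searchable (BitGraph k)
search-BitGraph k = search-× (search-Vec search-Bool k)
  (search-Vec (search-Vec (search-Vec (search-Vec search-Bool 3) k) 3) k)

module _ {k} (g : BitGraph k) where

  HasVertex : Fin k → Set
  HasVertex a = T (lookup (proj₁ g) a)

  HasEdge : Fin k × Port → Fin k × Port → Set
  HasEdge (a , i) (a′ , i′) = T (lookup (lookup (lookup (lookup (proj₂ g) a) i) a′) i′)

  hasEdge? : ∀ x y → Dec (HasEdge x y)
  hasEdge? x y = T? _

  Valid : Set
  Valid =
    (∀ x y → HasEdge x y → HasEdge y x) ×
    (∀ x → ¬ HasEdge x x) ×
    (∀ x y z → HasEdge x y → HasEdge x z → y ≡ z) ×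
    (∀ x y → HasEdge x y → HasVertex (proj₁ x))

  valid? : Dec Valid
  valid? =
    (∀half λ x → ∀half λ y → hasEdge? x y →-dec hasEdge? y x) ×-dec
    (∀half λ x → ¬? (hasEdge? x x)) ×-dec
    (∀half λ x → ∀half λ y → ∀half λ z →
      hasEdge? x y →-dec hasEdge? x z →-dec Product.≡-dec Fin._≟_ Fin._≟_ y z) ×-dec
    (∀half λ x → ∀half λ y → hasEdge? x y →-dec T? _)
    where
    ∀half : {P : Fin k × Port → Set} → (∀ x → Dec (P x)) → Dec (∀ x → P x)
    ∀half = forall? (search-× Fin.any? Fin.any?)

  -- An edge of the graph carries a proof of Valid, so that every bit pattern
  -- denotes a graph, if only one without edges.

  bitGraph : PortGraph (Vₛ (Fin k))
  bitGraph = record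
    { vertex          = HasVertex
    ; edge            = λ x y → Valid × HasEdge x y
    ; vertex-resp     = λ { refl → id }
    ; edge-resp       = (λ { (refl , refl) → id }) , (λ { (refl , refl) → id })
    ; edge-sym        = λ { (v@(symmetric , _) , e) → v , symmetric _ _ e }
    ; edge-twoElement = λ { ((_ , irreflexive , _) , e) (refl , refl) → irreflexive _ e }
    ; edge-disjoint   = λ { ((_ , _ , disjoint , _) , e) (_ , e′) →
        let eq = disjoint _ _ _ e e′ in cong proj₁ eq , cong proj₂ eq }
    ; edge-vertex     = λ { ((_ , _ , _ , ended) , e) → ended _ _ e }
    }

  bitVertex? : ∀ a → Dec (vertex bitGraph a)
  bitVertex? a = T? _

  bitEdge? : ∀ x y → Dec (edge bitGraph x y)
  bitEdge? x y = valid? ×-dec hasEdge? x y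

decBit : {P : Set} → Dec P → ∃[ bit ] (P Fun.⇔ T bit)
decBit (yes p) = true , mk⇔ _ (λ _ → p)
decBit (no ¬p) = false , mk⇔ ¬p λ ()

-- Transport between V and Fin k

module _ (em : ExcludedMiddle 0ℓ) (G : PortGraph (Vₛ V)) (ι : Fin k → V)
         (ι-inj : Injective _≡_ _≡_ ι) where

  -- Vertices and edges of `G` are arbitrary propositions, turned into bits by excluded middle. The
  -- bits are valid because `G` is a graph; disjointness of edges also uses that `ι` is injective.
  restriction : ∃[ g ] Embedding ι (bitGraph g) G
  restriction = g , record
    { ι-injective = ι-inj
    ; vertex-⇔    = V⇔
    ; edge-⇔      = λ x y → mk⇔ (λ e → valid , to (E⇔ x y) e) (from (E⇔ x y) ∘ proj₂)
    }
    where
    vertexChoice = vec-choice λ a → decBit (em {vertex G (ι a)})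
    edgeChoice = vec-choice λ a → vec-choice λ i → vec-choice λ a′ → vec-choice λ i′ →
      decBit (em {edge G (ι a , i) (ι a′ , i′)})

    g : BitGraph k
    g = proj₁ vertexChoice , proj₁ edgeChoice

    V⇔ : ∀ a → vertex G (ι a) Fun.⇔ HasVertex g a
    V⇔ = proj₂ vertexChoice

    E⇔ : ∀ x y → edge G (map₁ ι x) (map₁ ι y) Fun.⇔ HasEdge g x y
    E⇔ (a , i) (a′ , i′) = proj₂ edgeChoice a i a′ i′

    valid : Valid g
    valid =
      (λ x y → to (E⇔ y x) ∘ edge-sym G ∘ from (E⇔ x y)) ,
      (λ x e → edge-twoElement G (from (E⇔ x x) e) (refl , refl)) ,
      (λ x y z e e′ → let eq , eq′ = edge-disjoint G (from (E⇔ x y) e) (from (E⇔ x z) e′)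
                      in cong₂ _,_ (ι-inj eq) eq′) ,
      (λ x y → to (V⇔ _) ∘ edge-vertex G ∘ from (E⇔ x y))

module _ {g : PortGraph (Vₛ (Fin k))} (vertex? : ∀ a → Dec (vertex g a))
         {ι : Fin k → V} (ι-inj : Injective _≡_ _≡_ ι) where

  pushforward : Graph (Vₛ V)
  pushforward = record
    { portGraph = record
      { vertex          = λ v → ∃[ a ] ι a ≡ v × vertex g a
      ; edge            = λ x y → ∃[ x′ ] ∃[ y′ ] map₁ ι x′ ≡ x × map₁ ι y′ ≡ y × edge g x′ y′
      ; vertex-resp     = λ { refl → id }
      ; edge-resp       = (λ { (refl , refl) → id }) , (λ { (refl , refl) → id })
      ; edge-sym        = λ (x′ , y′ , eq , eq′ , e) → y′ , x′ , eq′ , eq , edge-sym g e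
      ; edge-twoElement = λ { (_ , _ , refl , refl , e) (eq , eq′) →
          edge-twoElement g e (ι-inj eq , eq′) }
      ; edge-disjoint   = disjoint
      ; edge-vertex     = λ { (_ , _ , refl , _ , e) → _ , refl , edge-vertex g e }
      }
    ; countable = finite-countable enum λ { (a , refl , a∈g) → a , enum-hits a a∈g }
    }
    where
    disjoint : ∀ {x y z : V × Port} →
               (∃[ x′ ] ∃[ y′ ] map₁ ι x′ ≡ x × map₁ ι y′ ≡ y × edge g x′ y′) →
               (∃[ x′ ] ∃[ z′ ] map₁ ι x′ ≡ x × map₁ ι z′ ≡ z × edge g x′ z′) →
               proj₁ y ≡ proj₁ z × proj₂ y ≡ proj₂ z
    disjoint (_ , _ , refl , refl , e) (_ , _ , eq , refl , e′)
      with refl ← ι-inj (cong proj₁ eq) | refl ← cong proj₂ eq =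
      let eq , eq′ = edge-disjoint g e e′ in cong ι eq , eq′

    -- Points of `Fin k` that are not vertices go to the extra point `nothing`.
    enum : Fin k → Maybe (∃[ v ] ∃[ a ] ι a ≡ v × vertex g a)
    enum a with vertex? a
    ... | yes a∈g = just (ι a , a , refl , a∈g)
    ... | no _    = nothing

    enum-hits : ∀ a → vertex g a → MaybeAny.Any (λ u → proj₁ u ≡ ι a) (enum a)
    enum-hits a a∈g with vertex? a
    ... | yes _  = MaybeAny.just refl
    ... | no a∉g = contradiction a∈g a∉g

  pushforward-embedding : Embedding ι g (portGraph pushforward)
  pushforward-embedding = record
    { ι-injective = ι-inj
    ; vertex-⇔    = λ a → mk⇔
        (λ (a′ , eq , a′∈g) → subst (vertex g) (ι-inj eq) a′∈g)
        (λ a∈g → a , refl , a∈g)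
    ; edge-⇔      = λ x y → mk⇔
        (λ (x′ , y′ , eqx , eqy , e) → subst₂ (edge g) (half-inj eqx) (half-inj eqy) e)
        (λ e → x , y , refl , refl , e)
    }
    where
    half-inj : {x y : Fin k × Port} → map₁ ι x ≡ map₁ ι y → x ≡ y
    half-inj eq = cong₂ _,_ (ι-inj (cong proj₁ eq)) (cong proj₂ eq)

module _ {ι : A → B} {g : PortGraph (Vₛ A)} {G : PortGraph (Vₛ B)} (emb : Embedding ι g G) where
  open Embedding emb

  -- This is why an induced subgraph inherits the bound `s`.
  longPath-push : LongPath g s → LongPath G s
  longPath-push (ws , (v , v∈g , e) , mono) =
    ws , (ι ∘ v , (λ i → from (vertex-⇔ _) (v∈g i)) , (λ i → from (edge-⇔ _ _) (e i))) , mono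

  -- A path of `G` could otherwise leave the range of `ι`. For the pushforward of a finite graph the
  -- range contains every vertex.
  longPath-pull : (∀ {v} → vertex G v → ∃[ a ] ι a ≡ v) → LongPath G s → LongPath g s
  longPath-pull covers (ws , (v , v∈G , e) , mono) =
    ws ,
    ( proj₁ ∘ a
    , (λ i → to (vertex-⇔ _) (subst (vertex G) (sym (proj₂ (a i))) (v∈G i)))
    , (λ i → to (edge-⇔ _ _) (subst₂ (λ x y → edge G (x , q (lookup ws) i) (y , p (lookup ws) i))
                                (sym (proj₂ (a (inject₁ i)))) (sym (proj₂ (a (fsuc i)))) (e i))) ) ,
    mono
    where a = λ i → covers (v∈G i)

-- Bounded search for a counterexample, and its correctness

module _ {b} (r : ℕ) (t : Table b) (s : ℕ) where

  CounterexampleOn : ℕ → Set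
  CounterexampleOn k = Σ[ g ∈ BitGraph k ] ¬ LongPath (bitGraph g) s ×
    Σ[ ms ∈ Vec (Move t (Fin k)) (suc s) ] Chain r (bitGraph g) (lookup ms)

  counterexampleOn? : ∀ k → Dec (CounterexampleOn k)
  counterexampleOn? k = search-BitGraph k λ g →
    ¬? (longPath? {G = bitGraph g} (bitVertex? g) (bitEdge? g) s) ×-dec
    search-Vec (search-Move t Fin.any?) (suc s)
      (λ ms → chain? {G = bitGraph g} (bitVertex? g) (bitEdge? g) r (lookup ms))

  Counterexample : Set
  -- A chain has `s + 1` moves, each placing at most `maxPlaces t` points; the outer `suc` lets `k`
  -- attain this bound.
  Counterexample = ∃[ k ] CounterexampleOn (toℕ {suc (suc s * maxPlaces t)} k)

  counterexample? : Dec Counterexample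
  counterexample? = Fin.any? λ k → counterexampleOn? (toℕ k)

module _ (em : ExcludedMiddle 0ℓ) {t : Table b} where

  -- The points placed by the chain are enumerated without repetition by `ι`, and `G` is restricted
  -- to them. All placements then lift along `ι`, so the chain survives in the restriction.
  counterexample-of-chain : (G : Graph (Vₛ V)) → BoundedStar G s →
                            Σ[ ms ∈ (Fin (suc s) → Move t V) ] Chain r (portGraph G) ms →
                            Counterexample r t s
  counterexample-of-chain {s = s} {r = r} G bounded (ms , chain)
    with xs , len , mem ← places t ms
    with k , k≤ , ι , ι-inj , covers ← enumerate (λ x y → em) xs
    with g , emb ← restriction em (portGraph G) ι ι-inj
    with ms′ , ms′≡ ← vec-choice (λ i → liftMove ι (ms i) (λ a → covers (mem i a))) =
    fromℕ< (s≤s (ℕ.≤-trans k≤ len)) ,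
    subst (CounterexampleOn r t s) (sym (Fin.toℕ-fromℕ< _))
      (g , (λ long → boundedStar⇒¬longPath {G = G} bounded (longPath-push emb long)) ,
       ms′ , chain-pull emb {ms = lookup ms′} (chain-resp (sym ∘ ms′≡) chain))

module _ (em : ExcludedMiddle 0ℓ) {V : Set} {r b : ℕ} {f : LocalRule V r b} {t : Table b}
         (tab : Tabulates f t) {s : ℕ} where

  -- An injection of `Fin k` into `V` turns the finite graph into one that `f` acts on. It has no
  -- further vertices, so its disks, its bound and the chain all carry over.
  counterexample⇒¬preserving : Uncountable V → Counterexample r t s → ¬ BoundedStarPreserving f s
  counterexample⇒¬preserving unc (k , g , ¬long , ms , chain) preserving =
    ¬bounded-of-chain _≟_ f tab G {ms = mapMove (proj₁ ι-ext) ∘ lookup ms}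
      (chain-push emb covers {ms = lookup ms} chain)
      (preserving G (¬longPath⇒boundedStar {G = G} (¬long ∘ longPath-pull emb covers)))
    where
    _≟_ : DecidableEquality V
    x ≟ y = em

    ι-ext = finiteInjection em unc (toℕ k)
    G   = pushforward {g = bitGraph g} (bitVertex? g) (proj₂ ι-ext)
    emb = pushforward-embedding {g = bitGraph g} (bitVertex? g) (proj₂ ι-ext)

    covers : ∀ {v} → vertex (portGraph G) v → ∃[ a ] proj₁ ι-ext a ≡ v
    covers (a , eq , _) = a , eq

  ¬counterexample⇒preserving : ¬ Counterexample r t s → BoundedStarPreserving f s
  ¬counterexample⇒preserving ¬cex G bounded = ¬longPath⇒boundedStar {G = dynamics f G} λ long →
    ¬cex (counterexample-of-chain em G bounded (chain-of-path (λ x y → em) f tab G long))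

proposition2 : Σ[ decide ∈ ((r b : ℕ) → Table b → ℕ → Bool) ]
    (ExcludedMiddle (lsuc 0ℓ) →
    (V : Set) → Uncountable V →
    (r b : ℕ) (f : LocalRule V r b) (t : Table b) → Tabulates f t →
    (s : ℕ) → Reflects (BoundedStarPreserving f s) (decide r b t s))
-- The decider is computed from `r`, `b`, `t` and `s` alone; excluded middle, `V` and `f` enter only
-- the proof that its answer is right. Since `map′` keeps the boolean, the bit reflected is the
-- decider's own.
proposition2 = (λ r b t s → does (¬? (counterexample? r t s))) ,
  λ em V unc r b f t tab s → proof (map′
    (¬counterexample⇒preserving (lower-em em) {f = f} tab)
    (λ preserving cex → counterexample⇒¬preserving (lower-em em) {f = f} tab unc cex preserving)
    (¬? (counterexample? r t s)))
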